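{- Let $B$ be a finite skew brace with $(B,+)$ abelian such that $\Lambda(B)$ has exactly one vertex. Then $B$ is isomorphic to one of: (1) $\mathbb{Z}/4\mathbb{Z}$ with its usual addition and $x\circ y=x+y+2xy$; (2) $\mathbb{Z}/2\mathbb{Z}\times\mathbb{Z}/2\mathbb{Z}$ with componentwise addition and $(x_1,y_1)\circ(x_2,y_2)=(x_1+x_2+y_1y_2,\,y_1+y_2)$; (3) $\mathbb{Z}/2\mathbb{Z}\times\mathbb{Z}/4\mathbb{Z}$ with componentwise addition and $(x_1,y_1)\circ(x_2,y_2)=\big(x_1+x_2+\varepsilon(y_1)y_2,\,y_1+y_2+2y_1y_2\big)$, where $\varepsilon(y_1)=0$ if $y_1\in\{0,1\}$ and $\varepsilon(y_1)=1$ if $y_1\in\{2,3\}$ (i.e. $\varepsilon(y_1)=\sum_{i=1}^{y_1-1}i \bmod 2$ for the representative $y_1\in\{0,1,2,3\}$), and $\varepsilon(y_1)y_2$ is computed in $\mathbb{Z}/2\mathbb{Z}$.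
   Context: A skew brace is a triple $(A,+,\circ)$ where $(A,+)$ and $(A,\circ)$ are groups with $a\circ(b+c)=a\circ b-a+a\circ c$. $\lambda_a(b)=-a+a\circ b$ defines an action of $(A,\circ)$ on $(A,+)$ by automorphisms. $\Lambda(A)$ is the graph whose vertices are the $\lambda$-orbits of size $>1$, two distinct vertices $L_1,L_2$ adjacent iff $\gcd(|L_1|,|L_2|)\ne1$. -}

module Defs where

open import Algebra.Bundles using (RawGroup)
open import Algebra.Core using (Op₁; Op₂)
open import Algebra.Morphism.Structures using (module GroupMorphisms)
open import Algebra.Structures using (IsGroup)
open import Data.Fin.Base using (Fin; toℕ)
open import Data.Fin.Patterns using (0F; 1F; 2F; 3F)
import Data.Fin.Properties as Fin
open import Data.Fin.Subset using (Subset; _∈_; ∣_∣)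
open import Data.Nat.Base as ℕ using (ℕ; NonZero; _<_)
open import Data.Nat.DivMod using (_mod_)
open import Data.Nat.GCD using (gcd)
open import Data.Product using (Σ-syntax; ∃-syntax; _×_; _,_)
open import Data.Product.Properties using (≡-dec)
open import Function.Bundles using (Inverse; _⇔_)
open import Level using (Level; 0ℓ; _⊔_; suc)
open import Relation.Binary.Bundles using (Setoid)
open import Relation.Binary.Core using (Rel)
open import Relation.Binary.Definitions using (DecidableEquality)
open import Relation.Binary.PropositionalEquality
  using (_≡_; _≢_; cong; cong₂; isEquivalence)
import Relation.Binary.PropositionalEquality.Properties as ≡
open import Relation.Nullary.Decidable using (Dec; map′; _×-dec_; from-yes)
open import Relation.Unary using (Pred; Decidable)

private
  variable
    c₁ c₂ ℓ₁ ℓ₂ : Level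

record SkewBrace c ℓ : Set (suc (c ⊔ ℓ)) where
  infixl 6 _+_
  infixl 7 _∘_
  infix  8 -_
  infix  4 _≈_
  field
    Carrier   : Set c
    _≈_       : Rel Carrier ℓ
    _+_       : Op₂ Carrier
    0#        : Carrier
    -_        : Op₁ Carrier
    _∘_       : Op₂ Carrier
    1#        : Carrier
    _⁻¹       : Op₁ Carrier
    +-isGroup : IsGroup _≈_ _+_ 0# -_
    ∘-isGroup : IsGroup _≈_ _∘_ 1# _⁻¹
    ∘-distrib : ∀ a b d → a ∘ (b + d) ≈ a ∘ b + - a + a ∘ d

  setoid : Setoid c ℓ
  setoid = record { isEquivalence = IsGroup.isEquivalence +-isGroup }

  +-rawGroup : RawGroup c ℓ
  +-rawGroup = record { _≈_ = _≈_ ; _∙_ = _+_ ; ε = 0# ; _⁻¹ = -_ }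

  ∘-rawGroup : RawGroup c ℓ
  ∘-rawGroup = record { _≈_ = _≈_ ; _∙_ = _∘_ ; ε = 1# ; _⁻¹ = _⁻¹ }

  -- λ_a(b), as λ is a reserved word.
  act : Carrier → Carrier → Carrier
  act a b = - a + a ∘ b

infix 4 _≅_

_≅_ : SkewBrace c₁ ℓ₁ → SkewBrace c₂ ℓ₂ → Set (c₁ ⊔ c₂ ⊔ ℓ₁ ⊔ ℓ₂)
A ≅ B = ∃[ f ] +.IsGroupIsomorphism f × ∘.IsGroupIsomorphism f
  where
  module + = GroupMorphisms (SkewBrace.+-rawGroup A) (SkewBrace.+-rawGroup B)
  module ∘ = GroupMorphisms (SkewBrace.∘-rawGroup A) (SkewBrace.∘-rawGroup B)

record Finite (B : SkewBrace c₁ ℓ₁) : Set (c₁ ⊔ ℓ₁) where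
  field
    size        : ℕ
    enumeration : Inverse (≡.setoid (Fin size)) (SkewBrace.setoid B)

  elem : Fin size → SkewBrace.Carrier B
  elem = Inverse.to enumeration

record Graph v e r : Set (suc (v ⊔ e ⊔ r)) where
  infix 4 _≈_ _~_
  field
    Vertex : Set v
    _≈_    : Rel Vertex e
    _~_    : Rel Vertex r

HasExactlyOneVertex : ∀ {v e r} → Graph v e r → Set (v ⊔ e)
HasExactlyOneVertex G = ∃[ v ] ∀ w → v ≈ w
  where open Graph G

-- A set of elements of a finite skew brace is given by its set of indices in the
-- enumeration.
module _ (B : SkewBrace c₁ ℓ₁) (fin : Finite B) where
  open SkewBrace B
  open Finite fin

  IsOrbit : Subset size → Set (c₁ ⊔ ℓ₁)
  IsOrbit L = ∃[ b ] ∀ i → i ∈ L ⇔ (∃[ a ] act a b ≈ elem i)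

  -- A vertex carries a proof that it is an orbit; vertices are equal when the
  -- underlying subsets are.
  Λ : Graph (c₁ ⊔ ℓ₁) 0ℓ 0ℓ
  Λ = record
    { Vertex = Σ[ L ∈ Subset size ] IsOrbit L × 1 < ∣ L ∣
    ; _≈_    = λ (L₁ , _) (L₂ , _) → L₁ ≡ L₂
    ; _~_    = λ (L₁ , _) (L₂ , _) → L₁ ≢ L₂ × gcd ∣ L₁ ∣ ∣ L₂ ∣ ≢ 1
    }

-- ℤ/nℤ, on the representatives 0, …, n - 1.
module Mod (n : ℕ) .{{_ : NonZero n}} where
  infixl 6 _⊕_
  infixl 7 _⊗_
  infix  8 ⊖_

  _⊕_ _⊗_ : Op₂ (Fin n)
  x ⊕ y = (toℕ x ℕ.+ toℕ y) mod n
  x ⊗ y = (toℕ x ℕ.* toℕ y) mod n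

  ⊖_ : Op₁ (Fin n)
  ⊖ x = (n ℕ.∸ toℕ x) mod n

module ByEnumeration
  {A : Set} (_≟_ : DecidableEquality A)
  (∀? : ∀ {P : Pred A 0ℓ} → Decidable P → Dec (∀ x → P x)) where

  isGroup? : ∀ (_∙_ : Op₂ A) ε (_⁻¹ : Op₁ A) → Dec (IsGroup _≡_ _∙_ ε _⁻¹)
  isGroup? _∙_ ε _⁻¹ = map′
    (λ (assoc , identityˡ , identityʳ , inverseˡ , inverseʳ) → record
      { isMonoid = record
        { isSemigroup = record
          { isMagma = record { isEquivalence = isEquivalence ; ∙-cong = cong₂ _∙_ }
          ; assoc   = assoc
          }
        ; identity = identityˡ , identityʳ
        }
      ; inverse = inverseˡ , inverseʳ
      ; ⁻¹-cong = cong _⁻¹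
      })
    (λ G → let open IsGroup G in
      assoc , identityˡ , identityʳ , inverseˡ , inverseʳ)
    ( (∀? λ x → ∀? λ y → ∀? λ z → ((x ∙ y) ∙ z) ≟ (x ∙ (y ∙ z)))
    ×-dec (∀? λ x → (ε ∙ x) ≟ x)
    ×-dec (∀? λ x → (x ∙ ε) ≟ x)
    ×-dec (∀? λ x → ((x ⁻¹) ∙ x) ≟ ε)
    ×-dec (∀? λ x → (x ∙ (x ⁻¹)) ≟ ε))

  distrib? : (_+_ _∘_ : Op₂ A) (-_ : Op₁ A) →
             Dec (∀ a b d → (a ∘ (b + d)) ≡ (((a ∘ b) + (- a)) + (a ∘ d)))
  distrib? _+_ _∘_ -_ = ∀? λ a → ∀? λ b → ∀? λ d →
    (a ∘ (b + d)) ≟ (((a ∘ b) + (- a)) + (a ∘ d))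

∀×? : ∀ {m n} {P : Pred (Fin m × Fin n) 0ℓ} → Decidable P → Dec (∀ x → P x)
∀×? P? = map′ (λ p (x , y) → p x y) (λ p x y → p (x , y))
  (Fin.all? λ x → Fin.all? λ y → P? (x , y))

module Brace₁ where
  open Mod 4

  _∘_ : Op₂ (Fin 4)
  x ∘ y = x ⊕ y ⊕ 2F ⊗ x ⊗ y

  _⁻¹ : Op₁ (Fin 4)
  x ⁻¹ = x

  open ByEnumeration (Fin._≟_ {4}) Fin.all?

  brace : SkewBrace 0ℓ 0ℓ
  brace = record
    { Carrier   = Fin 4
    ; _≈_       = _≡_
    ; _+_       = _⊕_
    ; 0#        = 0F
    ; -_        = ⊖_
    ; _∘_       = _∘_
    ; 1#        = 0F
    ; _⁻¹       = _⁻¹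
    ; +-isGroup = from-yes (isGroup? _⊕_ 0F ⊖_)
    ; ∘-isGroup = from-yes (isGroup? _∘_ 0F _⁻¹)
    ; ∘-distrib = from-yes (distrib? _⊕_ _∘_ ⊖_)
    }

module Brace₂ where
  open Mod 2

  _+_ _∘_ : Op₂ (Fin 2 × Fin 2)
  (x₁ , y₁) + (x₂ , y₂) = x₁ ⊕ x₂ , y₁ ⊕ y₂
  (x₁ , y₁) ∘ (x₂ , y₂) = x₁ ⊕ x₂ ⊕ y₁ ⊗ y₂ , y₁ ⊕ y₂

  -_ _⁻¹ : Op₁ (Fin 2 × Fin 2)
  - (x , y)  = ⊖ x , ⊖ y
  (x , y) ⁻¹ = x ⊕ y , y

  open ByEnumeration (≡-dec (Fin._≟_ {2}) (Fin._≟_ {2})) ∀×?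

  brace : SkewBrace 0ℓ 0ℓ
  brace = record
    { Carrier   = Fin 2 × Fin 2
    ; _≈_       = _≡_
    ; _+_       = _+_
    ; 0#        = 0F , 0F
    ; -_        = -_
    ; _∘_       = _∘_
    ; 1#        = 0F , 0F
    ; _⁻¹       = _⁻¹
    ; +-isGroup = from-yes (isGroup? _+_ (0F , 0F) -_)
    ; ∘-isGroup = from-yes (isGroup? _∘_ (0F , 0F) _⁻¹)
    ; ∘-distrib = from-yes (distrib? _+_ _∘_ -_)
    }

module Brace₃ where
  open Mod 2 renaming (_⊕_ to infixl 6 _⊕₂_; _⊗_ to infixl 7 _⊗₂_; ⊖_ to infix 8 ⊖₂_)
  open Mod 4 renaming (_⊕_ to infixl 6 _⊕₄_; _⊗_ to infixl 7 _⊗₄_; ⊖_ to infix 8 ⊖₄_)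

  ε : Fin 4 → Fin 2
  ε 0F = 0F
  ε 1F = 0F
  ε 2F = 1F
  ε 3F = 1F

  reduce : Fin 4 → Fin 2
  reduce y = toℕ y mod 2

  _+_ _∘_ : Op₂ (Fin 2 × Fin 4)
  (x₁ , y₁) + (x₂ , y₂) = x₁ ⊕₂ x₂ , y₁ ⊕₄ y₂
  (x₁ , y₁) ∘ (x₂ , y₂) =
    x₁ ⊕₂ x₂ ⊕₂ ε y₁ ⊗₂ reduce y₂ , y₁ ⊕₄ y₂ ⊕₄ 2F ⊗₄ y₁ ⊗₄ y₂

  -_ _⁻¹ : Op₁ (Fin 2 × Fin 4)
  - (x , y)  = ⊖₂ x , ⊖₄ y
  (x , y) ⁻¹ = x ⊕₂ ε y ⊗₂ reduce y , y

  open ByEnumeration (≡-dec (Fin._≟_ {2}) (Fin._≟_ {4})) ∀×?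

  brace : SkewBrace 0ℓ 0ℓ
  brace = record
    { Carrier   = Fin 2 × Fin 4
    ; _≈_       = _≡_
    ; _+_       = _+_
    ; 0#        = 0F , 0F
    ; -_        = -_
    ; _∘_       = _∘_
    ; 1#        = 0F , 0F
    ; _⁻¹       = _⁻¹
    ; +-isGroup = from-yes (isGroup? _+_ (0F , 0F) -_)
    ; ∘-isGroup = from-yes (isGroup? _∘_ (0F , 0F) _⁻¹)
    ; ∘-distrib = from-yes (distrib? _+_ _∘_ -_)
    }

{-# OPTIONS --safe #-}
-- Let F be the subgroup of points fixed by λ; the single vertex is the orbit B \ F of some
-- x. Since |B \ F| divides |B| and |F| divides |B|, F has index 2, so λ_a(y) = y + φ(a)
-- for all y ∉ F, with φ a homomorphism from (B,∘) onto (F,+) whose kernel has order 2.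
-- Applying λ_a to 2x ∈ F shows 2F = 0, and applying φ to f ∘ x shows that φ squares to zero
-- on F; hence |F| ≤ 4. Expanding φ(x ∘ x) determines 2x up to the choice of x, and
-- φ(φ(x)) = 0 or not separates braces (1), (2) from (3).
--
-- The divisibility arguments are replaced by one injection B → B that would miss an
-- element if F had larger index or φ a larger kernel (no-room).
module Submission where

open import Algebra.Bundles using (AbelianGroup; Group)
open import Algebra.Definitions using (Commutative)
open import Algebra.Morphism.Structures using (module GroupMorphisms)
import Algebra.Properties.AbelianGroup as AbelianGroupProperties
import Algebra.Properties.CommutativeMonoid.Mult as CommutativeMonoidMult
import Algebra.Properties.Group as GroupProperties
import Algebra.Solver.CommutativeMonoid as CommutativeMonoidSolver
open import Data.Empty using (⊥)
open import Data.Fin.Base using (Fin; toℕ; punchOut)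
open import Data.Fin.Patterns using (0F; 1F; 2F; 3F)
import Data.Fin.Properties as Fin
open import Data.Fin.Subset using (Subset; _∈_; ∣_∣; ⁅_⁆)
open import Data.Fin.Subset.Properties
  using (x∈⁅x⁆; x∈⁅y⁆⇒x≡y; ∣⁅x⁆∣≡1; p⊆q⇒∣p∣≤∣q∣; p⊂q⇒∣p∣<∣q∣)
open import Data.Nat.Base as ℕ using (ℕ; zero; suc; NonZero; _<_)
open import Data.Nat.DivMod using (_mod_; _%_; _/_; m%n<n; m≡m%n+[m/n]*n)
import Data.Nat.Properties as ℕ
open import Data.Product.Base using (∃-syntax; ∃₂; _×_; _,_; proj₁; proj₂)
open import Data.Sum.Base as Sum using (_⊎_; inj₁; inj₂; [_,_]′)
open import Data.Vec.Base using (tabulate)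
open import Data.Vec.Properties using (lookup∘tabulate; []=⇒lookup; lookup⇒[]=)
open import Function.Base using (_∘′_; id)
open import Function.Bundles using (Inverse; Equivalence; mk⇔)
open import Function.Definitions using (Congruent)
open import Relation.Binary.PropositionalEquality as ≡ using (_≡_; _≢_)
import Relation.Binary.Reasoning.Setoid as SetoidReasoning
open import Relation.Nullary.Decidable
  using (Dec; yes; no; does; proof; map′; ¬?; decidable-stable; dec-true)
open import Relation.Nullary.Negation using (¬_; contradiction)
open import Relation.Nullary.Reflects using (Reflects; invert)

open import Defs

-- Groups and the pigeonhole principle

module Group⁺ {c ℓ} (G : Group c ℓ) where
  open Group G public hiding (_//_; _\\_; _-_)
  open GroupProperties G public

-- Punching out the missed value `k` leaves a map into a set with one element fewer, to which the
-- pigeonhole principle applies.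
avoiding⇒collision : ∀ {n} (f : Fin n → Fin n) k → (∀ i → f i ≢ k) →
                     ∃₂ λ i j → i ≢ j × f i ≡ f j
avoiding⇒collision {suc n} f k f≢k
  with i , j , i<j , eq ← Fin.pigeonhole (ℕ.n<1+n n) (λ i → punchOut (f≢k i ∘′ ≡.sym))
  = i , j , Fin.<⇒≢ i<j , Fin.punchOut-injective (f≢k i ∘′ ≡.sym) (f≢k j ∘′ ≡.sym) eq

-- The λ-action and its fixed points when addition is commutative

module AbelianType {c ℓ} (B : SkewBrace c ℓ)
  (+-comm : Commutative (SkewBrace._≈_ B) (SkewBrace._+_ B)) where

  open SkewBrace B public

  +-abelianGroup : AbelianGroup c ℓ
  +-abelianGroup = record
    { isAbelianGroup = record { isGroup = +-isGroup ; comm = +-comm } }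

  ∘-group : Group c ℓ
  ∘-group = record { isGroup = ∘-isGroup }

  open AbelianGroup +-abelianGroup public
    using (refl; sym; trans; reflexive; assoc; comm; identityˡ; identityʳ; inverseˡ; inverseʳ)
    renaming ( group to +-group; commutativeMonoid to +-commutativeMonoid
             ; ∙-cong to +-cong; ∙-congˡ to +-congˡ; ∙-congʳ to +-congʳ; ⁻¹-cong to -‿cong )
  open AbelianGroupProperties +-abelianGroup public
    using (identityʳ-unique; inverseˡ-unique; x∙y⁻¹≈ε⇒x≈y)
    renaming (∙-cancelˡ to +-cancelˡ; ε⁻¹≈ε to -0≈0)
  module ∘ = Group⁺ ∘-group
  open CommutativeMonoidSolver +-commutativeMonoid public using (solve; _⊕_; _⊜_)
  open SetoidReasoning setoid public

  x+[y-x]≈y : ∀ x y → x + (y + - x) ≈ y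
  x+[y-x]≈y x y = begin
    x + (y + - x) ≈⟨ solve 3 (λ x y z → x ⊕ (y ⊕ z) ⊜ y ⊕ (x ⊕ z)) refl x y (- x) ⟩
    y + (x + - x) ≈⟨ +-congˡ (inverseʳ x) ⟩
    y + 0#        ≈⟨ identityʳ y ⟩
    y             ∎

  ∘≈+act : ∀ a b → a ∘ b ≈ a + act a b
  ∘≈+act a b = sym (begin
    a + (- a + a ∘ b) ≈⟨ assoc a (- a) (a ∘ b) ⟨
    a + - a + a ∘ b   ≈⟨ +-congʳ (inverseʳ a) ⟩
    0# + a ∘ b        ≈⟨ identityˡ _ ⟩
    a ∘ b             ∎)

  act-cong : ∀ {a a′ b b′} → a ≈ a′ → b ≈ b′ → act a b ≈ act a′ b′
  act-cong p q = +-cong (-‿cong p) (∘.∙-cong p q)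

  act-congˡ : ∀ a {b b′} → b ≈ b′ → act a b ≈ act a b′
  act-congˡ a = act-cong refl

  act-+ : ∀ a b d → act a (b + d) ≈ act a b + act a d
  act-+ a b d = trans (+-congˡ (∘-distrib a b d))
    (solve 3 (λ n p q → n ⊕ ((p ⊕ n) ⊕ q) ⊜ (n ⊕ p) ⊕ (n ⊕ q)) refl (- a) (a ∘ b) (a ∘ d))

  -- After adding `a ∘ b` to both sides, this is associativity of `∘` combined with the brace
  -- identity.
  act-∘ : ∀ a b d → act (a ∘ b) d ≈ act a (act b d)
  act-∘ a b d = +-cancelˡ (a ∘ b) _ _ (begin
    a ∘ b + act (a ∘ b) d         ≈⟨ ∘≈+act (a ∘ b) d ⟨
    (a ∘ b) ∘ d                   ≈⟨ ∘.assoc a b d ⟩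
    a ∘ (b ∘ d)                   ≈⟨ ∘.∙-congˡ (∘≈+act b d) ⟩
    a ∘ (b + act b d)             ≈⟨ ∘-distrib a b (act b d) ⟩
    a ∘ b + - a + a ∘ act b d     ≈⟨ assoc _ _ _ ⟩
    a ∘ b + act a (act b d)       ∎)

  act-zeroʳ : ∀ a → act a 0# ≈ 0#
  act-zeroʳ a = identityʳ-unique (act a 0#) (act a 0#)
    (trans (sym (act-+ a 0# 0#)) (act-congˡ a (identityʳ 0#)))

  -- Since λ preserves `0#`, the additive zero is idempotent for `∘`, and the only idempotent of a
  -- group is its identity.
  0≈1 : 0# ≈ 1#
  0≈1 = ∘.identityʳ-unique 0# 0#
    (trans (∘≈+act 0# 0#) (trans (identityˡ _) (act-zeroʳ 0#)))

  act-zeroˡ : ∀ b → act 0# b ≈ b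
  act-zeroˡ b = begin
    - 0# + 0# ∘ b ≈⟨ +-cong -0≈0 (trans (∘.∙-congʳ 0≈1) (∘.identityˡ b)) ⟩
    0# + b        ≈⟨ identityˡ b ⟩
    b             ∎

  act-⁻¹ : ∀ a b → act (a ⁻¹) (act a b) ≈ b
  act-⁻¹ a b = begin
    act (a ⁻¹) (act a b) ≈⟨ act-∘ (a ⁻¹) a b ⟨
    act (a ⁻¹ ∘ a) b     ≈⟨ act-cong (trans (∘.inverseˡ a) (sym 0≈1)) refl ⟩
    act 0# b             ≈⟨ act-zeroˡ b ⟩
    b                    ∎

  act-neg : ∀ a b → act a (- b) ≈ - act a b
  act-neg a b = inverseˡ-unique _ _ (begin
    act a (- b) + act a b ≈⟨ act-+ a (- b) b ⟨
    act a (- b + b)       ≈⟨ act-congˡ a (inverseˡ b) ⟩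
    act a 0#              ≈⟨ act-zeroʳ a ⟩
    0#                    ∎)

  Fixed : Carrier → Set _
  Fixed b = ∀ a → act a b ≈ b

  fixed-resp : ∀ {b b′} → b ≈ b′ → Fixed b → Fixed b′
  fixed-resp eq fix a = trans (act-congˡ a (sym eq)) (trans (fix a) eq)

  fixed-0 : Fixed 0#
  fixed-0 = act-zeroʳ

  fixed-+ : ∀ {b d} → Fixed b → Fixed d → Fixed (b + d)
  fixed-+ {b} {d} fix-b fix-d a = trans (act-+ a b d) (+-cong (fix-b a) (fix-d a))

  fixed-neg : ∀ {b} → Fixed b → Fixed (- b)
  fixed-neg {b} fix a = trans (act-neg a b) (-‿cong (fix a))

  fixed-cancelʳ : ∀ {b d} → Fixed d → Fixed (b + d) → Fixed b
  fixed-cancelʳ {b} {d} fix-d fix = fixed-resp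
    (trans (assoc b d (- d)) (trans (+-congˡ (inverseʳ d)) (identityʳ b)))
    (fixed-+ fix (fixed-neg fix-d))

  ∘≈+ : ∀ a {f} → Fixed f → a ∘ f ≈ a + f
  ∘≈+ a {f} fix = trans (∘≈+act a f) (+-congˡ (fix a))

-- Finite braces: decidability, counting and orbits

module FiniteAbelianType {c ℓ} (B : SkewBrace c ℓ) (fin : Finite B)
  (+-comm : Commutative (SkewBrace._≈_ B) (SkewBrace._+_ B)) where

  open AbelianType B +-comm public
  open Finite fin public
  open Inverse enumeration public using ()
    renaming ( from to index; from-cong to index-cong
             ; strictlyInverseˡ to elem∘index; strictlyInverseʳ to index∘elem )

  index-injective : ∀ {a b} → index a ≡ index b → a ≈ b
  index-injective {a} {b} eq =
    trans (sym (elem∘index a)) (trans (reflexive (≡.cong elem eq)) (elem∘index b))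

  elem-injective : ∀ {i j} → elem i ≈ elem j → i ≡ j
  elem-injective {i} {j} eq =
    ≡.trans (≡.sym (index∘elem i)) (≡.trans (index-cong eq) (index∘elem j))

  infix 4 _≟_

  abstract
    _≟_ : ∀ a b → Dec (a ≈ b)
    a ≟ b = map′ index-injective index-cong (index a Fin.≟ index b)

    Fixed? : ∀ b → Dec (Fixed b)
    Fixed? b = map′
      (λ fix a → trans (act-cong (sym (elem∘index a)) refl) (fix (index a)))
      (λ fix i → fix (elem i))
      (Fin.all? λ i → act (elem i) b ≟ b)

    orbit? : ∀ b d → Dec (∃[ a ] act a b ≈ d)
    orbit? b d = map′
      (λ (i , eq) → elem i , eq)
      (λ (a , eq) → index a , trans (act-cong (elem∘index a) refl) eq)
      (Fin.any? λ i → act (elem i) b ≟ d)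

    -- All counting below goes through this form of finiteness: a self-map that is injective up to
    -- `≈` misses nothing. Sampling `h` at the points `elem i` turns distinct indices into
    -- inequivalent elements.
    missed⇒collision : ∀ (h : Carrier → Carrier) k → (∀ a → ¬ h a ≈ k) →
                       ∃₂ λ a b → ¬ a ≈ b × h a ≈ h b
    missed⇒collision h k h≉k
      with i , j , i≢j , eq ← avoiding⇒collision (λ i → index (h (elem i))) (index k)
                                (λ i → h≉k (elem i) ∘′ index-injective)
      = elem i , elem j , i≢j ∘′ elem-injective , index-injective eq

  orbit : Carrier → Subset size
  orbit b = tabulate λ i → does (orbit? b (elem i))

  orbit-isOrbit : ∀ b → IsOrbit B fin (orbit b)
  orbit-isOrbit b = b , λ i → mk⇔ to (from i)
    where
    to : ∀ {i} → i ∈ orbit b → ∃[ a ] act a b ≈ elem i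
    to {i} i∈ = invert (≡.subst (Reflects _)
      (≡.trans (≡.sym (lookup∘tabulate _ i)) ([]=⇒lookup i∈)) (proof (orbit? b (elem i))))

    from : ∀ i → ∃[ a ] act a b ≈ elem i → i ∈ orbit b
    from i p = lookup⇒[]= i _ (≡.trans (lookup∘tabulate _ i) (dec-true (orbit? b (elem i)) p))

  -- The singleton of `b` is a proper subset of `L`: acting by `0#` puts `b` into `L`, and a search
  -- through the enumeration finds an element that moves `b`.
  isOrbit⇒1<∣∣ : ∀ {L} ((b , _) : IsOrbit B fin L) → ¬ Fixed b → 1 < ∣ L ∣
  isOrbit⇒1<∣∣ {L} (b , L-orbit) ¬fix = ≡.subst (_< ∣ L ∣) (∣⁅x⁆∣≡1 (index b))
    (p⊂q⇒∣p∣<∣q∣ (b⊆L , moved))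
    where
    ∈L : ∀ a → index (act a b) ∈ L
    ∈L a = Equivalence.from (L-orbit _) (a , sym (elem∘index _))

    b⊆L : ∀ {i} → i ∈ ⁅ index b ⁆ → i ∈ L
    b⊆L i∈ = ≡.subst (_∈ L) (≡.trans (index-cong (act-zeroˡ b)) (≡.sym (x∈⁅y⁆⇒x≡y _ i∈))) (∈L 0#)

    moved : ∃[ i ] i ∈ L × ¬ i ∈ ⁅ index b ⁆
    moved with Fin.any? (λ i → ¬? (act (elem i) b ≟ b))
    ... | yes (i , ≉b) = _ , ∈L (elem i) , ≉b ∘′ index-injective ∘′ x∈⁅y⁆⇒x≡y _
    ... | no none = contradiction
      (λ a → decidable-stable (act a b ≟ b)
        λ ≉b → none (index a , ≉b ∘′ trans (act-cong (sym (elem∘index a)) refl)))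
      ¬fix

  1<∣∣⇒¬fixed : ∀ {L} ((b , _) : IsOrbit B fin L) → 1 < ∣ L ∣ → ¬ Fixed b
  1<∣∣⇒¬fixed {L} (b , L-orbit) 1<L fix = ℕ.<⇒≱ 1<L
    (≡.subst (∣ L ∣ ℕ.≤_) (∣⁅x⁆∣≡1 (index b)) (p⊆q⇒∣p∣≤∣q∣ L⊆b))
    where
    L⊆b : ∀ {i} → i ∈ L → i ∈ ⁅ index b ⁆
    L⊆b {i} i∈L with a , eq ← Equivalence.to (L-orbit i) i∈L =
      ≡.subst (_∈ ⁅ index b ⁆)
        (≡.trans (index-cong (trans (sym (fix a)) eq)) (index∘elem i)) (x∈⁅x⁆ _)

  SingleOrbit : Carrier → Set _
  SingleOrbit x = ∀ b → ¬ Fixed b → ∃[ a ] act a x ≈ b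

  -- The orbit of a non-fixed `b` is a vertex, hence equal to `L`, and `b` lies in its own orbit.
  -- Only this transitivity of λ on the non-fixed points is carried forward from the graph.
  oneVertex⇒singleOrbit : HasExactlyOneVertex (Λ B fin) →
                          ∃[ x ] ¬ Fixed x × SingleOrbit x
  oneVertex⇒singleOrbit ((L , L-isOrbit@(x , L-orbit) , 1<L) , unique) =
    x , 1<∣∣⇒¬fixed L-isOrbit 1<L , λ b ¬fix →
      let L≡ = unique (orbit b , orbit-isOrbit b , isOrbit⇒1<∣∣ (orbit-isOrbit b) ¬fix)
          b∈orbit = Equivalence.from (proj₂ (orbit-isOrbit b) (index b))
                      (0# , trans (act-zeroˡ b) (sym (elem∘index b)))
          a , eq = Equivalence.to (L-orbit (index b)) (≡.subst (index b ∈_) (≡.sym L≡) b∈orbit)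
      in a , trans eq (elem∘index b)

-- A single nontrivial orbit: the fixed points have index two

module OneOrbit {c ℓ} (B : SkewBrace c ℓ) (fin : Finite B)
  (+-comm : Commutative (SkewBrace._≈_ B) (SkewBrace._+_ B))
  (x : SkewBrace.Carrier B)
  (x-moves : ¬ AbelianType.Fixed B +-comm x)
  (single : FiniteAbelianType.SingleOrbit B fin +-comm x) where

  open FiniteAbelianType B fin +-comm public

  carrier : ∀ {b} → Dec (∃[ a ] act a x ≈ b) → Carrier
  carrier (yes (a , _)) = a
  -- A placeholder: `act-carrier` speaks only of non-fixed `b`, and these all lie in the orbit of
  -- `x`.
  carrier (no _)        = 0#

  act-carrier : ∀ {b} (d : Dec (∃[ a ] act a x ≈ b)) → ¬ Fixed b → act (carrier d) x ≈ b
  act-carrier (yes (_ , eq)) _    = eq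
  act-carrier (no ∉orbit)    ¬fix = contradiction (single _ ¬fix) ∉orbit

  -- Passing through index makes the choice of an element carrying x to b independent of
  -- the representative of b.
  section : Carrier → Carrier
  section b = carrier (orbit? x (elem (index b)))

  section-cong : ∀ {b d} → b ≈ d → section b ≈ section d
  section-cong eq = reflexive (≡.cong (λ i → carrier (orbit? x (elem i))) (index-cong eq))

  act-section : ∀ {b} → ¬ Fixed b → act (section b) x ≈ b
  act-section {b} ¬fix = trans
    (act-carrier (orbit? x (elem (index b))) (¬fix ∘′ fixed-resp (elem∘index b)))
    (elem∘index b)

  -- Acting by `a ⁻¹` takes `act a x` back to `x`, yet would leave a fixed point where it is.
  act-moves : ∀ a → ¬ Fixed (act a x)
  act-moves a fix = x-moves (fixed-resp (trans (sym (fix (a ⁻¹))) (act-⁻¹ a x)) fix)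

  -- a ↦ act a x never takes the value 0, so it is not injective.
  abstract
    stabilizer : ∃[ s ] ¬ s ≈ 0# × act s x ≈ x
    stabilizer =
      let a , b , a≉b , eq = missed⇒collision (λ a → act a x) 0#
            (λ a eq → act-moves a (fixed-resp (sym eq) fixed-0))
      in b ⁻¹ ∘ a
       , (λ eq₀ → a≉b (trans (∘.inverseʳ-unique (b ⁻¹) a (trans eq₀ 0≈1)) (∘.⁻¹-involutive b)))
       , trans (act-∘ (b ⁻¹) a x) (trans (act-congˡ (b ⁻¹) eq) (act-⁻¹ b x))

  s : Carrier
  s = proj₁ stabilizer

  s≉0 : ¬ s ≈ 0#
  s≉0 = proj₁ (proj₂ stabilizer)

  act-s : act s x ≈ x
  act-s = proj₂ (proj₂ stabilizer)

  -- Together with `∘s≉` this gives two distinct elements carrying `x` to `b`, namely `section b`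
  -- and `section b ∘ s`.
  act-∘s : ∀ {b} → ¬ Fixed b → act (section b ∘ s) x ≈ b
  act-∘s {b} ¬fix = trans (act-∘ (section b) s x) (trans (act-congˡ _ act-s) (act-section ¬fix))

  ∘s≉ : ∀ {d} b → ¬ d ≈ 0# → ¬ b ≈ b ∘ d
  ∘s≉ {d} b d≉0 eq = d≉0 (trans (∘.identityʳ-unique b d (sym eq)) (sym 0≈1))

  moves-+ : ∀ {y f} → ¬ Fixed y → Fixed f → ¬ Fixed (y + f)
  moves-+ ¬fix fix-f fix = ¬fix (fixed-cancelʳ fix-f fix)

  -- Sending a non-fixed b to section b and a fixed f to section (y + f) ∘ s is injective,
  -- hence onto.
  no-room : ∀ {y} → ¬ Fixed y → ∀ k → (∀ b → ¬ Fixed b → ¬ section b ≈ k) →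
            (∀ f → Fixed f → ¬ section (y + f) ∘ s ≈ k) → ⊥
  no-room {y} y-moves k ≉k₁ ≉k₂ =
    let a , b , a≉b , eq = missed⇒collision (λ b → h b (Fixed? b)) k (λ b → missed b (Fixed? b))
    in a≉b (h-injective a b (Fixed? a) (Fixed? b) eq)
    where
    h : ∀ b → Dec (Fixed b) → Carrier
    h b (yes _) = section (y + b) ∘ s
    h b (no _)  = section b

    missed : ∀ b d → ¬ h b d ≈ k
    missed b (yes fix) = ≉k₂ b fix
    missed b (no ¬fix) = ≉k₁ b ¬fix

    -- Equal values carry `x` to the same point, so `b ≈ y + f`; the two values then still differ by
    -- the nontrivial factor `s`.
    disjoint : ∀ {b f} → ¬ Fixed b → Fixed f → ¬ section b ≈ section (y + f) ∘ s
    disjoint {b} {f} ¬fix fix eq = ∘s≉ _ s≉0 (trans (sym (section-cong b≈y+f)) eq)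
      where
      b≈y+f : b ≈ y + f
      b≈y+f = trans (sym (act-section ¬fix))
                (trans (act-cong eq refl) (act-∘s (moves-+ y-moves fix)))

    h-injective : ∀ a b da db → h a da ≈ h b db → a ≈ b
    h-injective a b (no ¬a) (no ¬b) eq =
      trans (sym (act-section ¬a)) (trans (act-cong eq refl) (act-section ¬b))
    h-injective a b (yes fix-a) (yes fix-b) eq = +-cancelˡ y _ _
      (trans (sym (act-∘s (moves-+ y-moves fix-a)))
        (trans (act-cong eq refl) (act-∘s (moves-+ y-moves fix-b))))
    h-injective a b (no ¬a) (yes fix-b) eq = contradiction eq (disjoint ¬a fix-b)
    h-injective a b (yes fix-a) (no ¬b) eq = contradiction (sym eq) (disjoint ¬b fix-a)

  -- This is the index-two statement. If `z` lay outside the coset of `y`, the map in `no-room`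
  -- would miss `section z ∘ s`: a value `section b` there would force `b ≈ z` and then `s ≈ 0#`,
  -- and a value `section (y + f) ∘ s` would force `z ≈ y + f`.
  moves-difference : ∀ {y z} → ¬ Fixed y → ¬ Fixed z → Fixed (z + - y)
  moves-difference {y} {z} ¬y ¬z = decidable-stable (Fixed? _) λ ¬z-y →
    no-room ¬y (section z ∘ s)
      (λ b ¬b eq → ∘s≉ _ s≉0 (trans (section-cong
        (trans (sym (act-∘s ¬z)) (trans (act-cong (sym eq) refl) (act-section ¬b)))) eq))
      (λ f fix eq → ¬z-y (fixed-resp (+-cancelˡ y _ _ (begin
          y + f                              ≈⟨ act-∘s (moves-+ ¬y fix) ⟨
          act (section (y + f) ∘ s) x        ≈⟨ act-cong eq refl ⟩
          act (section z ∘ s) x              ≈⟨ act-∘s ¬z ⟩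
          z                                  ≈⟨ x+[y-x]≈y y z ⟨
          y + (z + - y)                      ∎)) fix))

  coset : ∀ {y} → ¬ Fixed y → ∀ b → Fixed b ⊎ ∃[ f ] Fixed f × b ≈ y + f
  coset {y} y-moves b = split (Fixed? b)
    where
    split : Dec (Fixed b) → Fixed b ⊎ ∃[ f ] Fixed f × b ≈ y + f
    split (yes fix) = inj₁ fix
    split (no ¬fix) = inj₂ (b + - y , moves-difference y-moves ¬fix , sym (x+[y-x]≈y y b))

  -- The displacement homomorphism φ

  φ : Carrier → Carrier
  φ a = act a x + - x

  act-x : ∀ a → act a x ≈ x + φ a
  act-x a = sym (x+[y-x]≈y x (act a x))

  φ-cong : ∀ {a b} → a ≈ b → φ a ≈ φ b
  φ-cong eq = +-congʳ (act-cong eq refl)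

  φ-fixed : ∀ a → Fixed (φ a)
  φ-fixed a = moves-difference x-moves (act-moves a)

  -- Write `y` as `x` plus a fixed point: only the summand `x` is displaced. Hence `φ`, although
  -- defined at `x`, describes the action on all non-fixed points.
  act-moving : ∀ {y} → ¬ Fixed y → ∀ a → act a y ≈ y + φ a
  act-moving {y} y-moves a = begin
    act a y                   ≈⟨ act-congˡ a (x+[y-x]≈y x y) ⟨
    act a (x + (y + - x))     ≈⟨ act-+ a x (y + - x) ⟩
    act a x + act a (y + - x) ≈⟨ +-cong (act-x a) (moves-difference x-moves y-moves a) ⟩
    (x + φ a) + (y + - x)
      ≈⟨ solve 3 (λ x p d → (x ⊕ p) ⊕ d ⊜ (x ⊕ d) ⊕ p) refl x (φ a) (y + - x) ⟩
    (x + (y + - x)) + φ a     ≈⟨ +-congʳ (x+[y-x]≈y x y) ⟩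
    y + φ a                   ∎

  φ-unique : ∀ {a f} → act a x ≈ x + f → φ a ≈ f
  φ-unique {a} eq = +-cancelˡ x _ _ (trans (sym (act-x a)) eq)

  φ≈0⇒act-x : ∀ {a} → φ a ≈ 0# → act a x ≈ x
  φ≈0⇒act-x {a} = x∙y⁻¹≈ε⇒x≈y (act a x) x

  -- `x + f` is again non-fixed, so by transitivity some element carries `x` to it.
  φ-surjective : ∀ {f} → Fixed f → ∃[ a ] φ a ≈ f
  φ-surjective fix = let a , eq = single _ (moves-+ x-moves fix) in a , φ-unique eq

  -- Displacements accumulate because `a` leaves the earlier displacement `φ b` fixed.
  φ-∘ : ∀ a b → φ (a ∘ b) ≈ φ a + φ b
  φ-∘ a b = φ-unique (begin
    act (a ∘ b) x         ≈⟨ act-∘ a b x ⟩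
    act a (act b x)       ≈⟨ act-congˡ a (act-x b) ⟩
    act a (x + φ b)       ≈⟨ act-+ a x (φ b) ⟩
    act a x + act a (φ b) ≈⟨ +-cong (act-x a) (φ-fixed b a) ⟩
    x + φ a + φ b         ≈⟨ assoc _ _ _ ⟩
    x + (φ a + φ b)       ∎)

  -- Adding a fixed point on the right is the same as multiplying by it, so this is an instance of
  -- `φ-∘`.
  φ-+ : ∀ a {f} → Fixed f → φ (a + f) ≈ φ a + φ f
  φ-+ a {f} fix = trans (φ-cong (sym (∘≈+ a fix))) (φ-∘ a f)

  φ-0 : φ 0# ≈ 0#
  φ-0 = φ-unique (trans (act-zeroˡ x) (sym (identityʳ x)))

  φ-s : φ s ≈ 0#
  φ-s = φ-unique (trans act-s (sym (identityʳ x)))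

  -- If `y + y` lay in the non-fixed coset, cancelling `y` would make `y` itself fixed.
  double-fixed : ∀ {y} → ¬ Fixed y → Fixed (y + y)
  double-fixed {y} y-moves = split (coset y-moves (y + y))
    where
    split : Fixed (y + y) ⊎ ∃[ f ] Fixed f × y + y ≈ y + f → Fixed (y + y)
    split (inj₁ fix)            = fix
    split (inj₂ (f , fix , eq)) =
      contradiction (fixed-resp (sym (+-cancelˡ y _ _ eq)) fix) y-moves

  -- An element `a` with `φ a ≈ f` sends `x + x` to `x + x + (f + f)`, while `x + x` is fixed.
  fixed-2-torsion : ∀ {f} → Fixed f → f + f ≈ 0#
  fixed-2-torsion {f} fix =
    let a , φa≈f = φ-surjective fix
        act-x≈ = trans (act-x a) (+-congˡ φa≈f)
    in identityʳ-unique (x + x) (f + f) (begin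
      x + x + (f + f)     ≈⟨ solve 2 (λ x f → (x ⊕ x) ⊕ (f ⊕ f) ⊜ (x ⊕ f) ⊕ (x ⊕ f)) refl x f ⟩
      (x + f) + (x + f)   ≈⟨ +-cong act-x≈ act-x≈ ⟨
      act a x + act a x   ≈⟨ act-+ a x x ⟨
      act a (x + x)       ≈⟨ double-fixed x-moves a ⟩
      x + x               ∎)

  -- Apply φ to f ∘ x = x + (f + φ f).
  φφ≈0 : ∀ {f} → Fixed f → φ (φ f) ≈ 0#
  φφ≈0 {f} fix = identityʳ-unique (φ f + φ x) (φ (φ f)) (begin
    φ f + φ x + φ (φ f)
      ≈⟨ solve 3 (λ p q r → (p ⊕ q) ⊕ r ⊜ q ⊕ (p ⊕ r)) refl (φ f) (φ x) (φ (φ f)) ⟩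
    φ x + (φ f + φ (φ f)) ≈⟨ +-congˡ (φ-+ f (φ-fixed f)) ⟨
    φ x + φ (f + φ f)     ≈⟨ φ-+ x (fixed-+ fix (φ-fixed f)) ⟨
    φ (x + (f + φ f))     ≈⟨ φ-cong (assoc x f (φ f)) ⟨
    φ (x + f + φ f)       ≈⟨ φ-cong (+-congʳ (comm x f)) ⟩
    φ (f + x + φ f)       ≈⟨ φ-cong (assoc f x (φ f)) ⟩
    φ (f + (x + φ f))     ≈⟨ φ-cong (+-congˡ (act-x f)) ⟨
    φ (f + act f x)       ≈⟨ φ-cong (∘≈+act f x) ⟨
    φ (f ∘ x)             ≈⟨ φ-∘ f x ⟩
    φ f + φ x             ∎)

  -- Apply φ to y ∘ y = y + y + φ y.
  φ-double : ∀ {y} → ¬ Fixed y → φ (y + y) + φ (φ y) ≈ 0#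
  φ-double {y} y-moves = begin
    φ (y + y) + φ (φ y) ≈⟨ φ-+ (y + y) (φ-fixed y) ⟨
    φ (y + y + φ y)     ≈⟨ φ-cong (trans (assoc _ _ _) (+-congˡ (sym (act-moving y-moves y)))) ⟩
    φ (y + act y y)     ≈⟨ φ-cong (∘≈+act y y) ⟨
    φ (y ∘ y)           ≈⟨ φ-∘ y y ⟩
    φ y + φ y           ≈⟨ fixed-2-torsion (φ-fixed y) ⟩
    0#                  ∎

  -- The only values of the map in `no-room` that stabilize `x` are `section x` and `section x ∘ s`,
  -- so a third kernel element `a` would make it miss `section x ∘ a`. The translate by `section x`
  -- appears because `section x` is just some element of the stabilizer, not necessarily `0#`.
  φ-kernel : ∀ {a} → φ a ≈ 0# → a ≈ 0# ⊎ a ≈ s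
  φ-kernel {a} φa≈0 with a ≟ 0# | a ≟ s
  ... | yes a≈0 | _       = inj₁ a≈0
  ... | no _    | yes a≈s = inj₂ a≈s
  ... | no a≉0  | no a≉s  = contradiction x-moves λ ¬x → no-room ¬x (section x ∘ a)
      (λ b ¬b eq → ∘s≉ _ a≉0 (trans (section-cong
        (trans (sym act-k) (trans (act-cong (sym eq) refl) (act-section ¬b)))) eq))
      (λ f fix eq → a≉s (∘.∙-cancelˡ (section x) _ _ (begin
        section x ∘ a       ≈⟨ eq ⟨
        section (x + f) ∘ s ≈⟨ ∘.∙-congʳ (section-cong
          (trans (sym (act-∘s (moves-+ x-moves fix))) (trans (act-cong eq refl) act-k))) ⟩
        section x ∘ s       ∎)))
    where
    act-k : act (section x ∘ a) x ≈ x
    act-k = trans (act-∘ _ a x)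
      (trans (act-congˡ _ (φ≈0⇒act-x φa≈0)) (act-section x-moves))

  -- This is the bound of four on the fixed points. Take a preimage of `f` under `φ`: if it is
  -- fixed, `f` lies in the kernel because `φ` squares to zero there; otherwise it is `y + g` with
  -- `g` fixed, and `f` is `φ y` plus the kernel element `φ g`.
  fixed-cases : ∀ {y f} → ¬ Fixed y → Fixed f →
                (f ≈ 0# ⊎ f ≈ s) ⊎ (f ≈ φ y ⊎ f ≈ φ y + s)
  fixed-cases {y} {f} y-moves fix = let a , φa≈f = φ-surjective fix in
    Sum.map (from-fixed φa≈f) (λ (g , fix-g , a≈y+g) → from-moved φa≈f fix-g a≈y+g)
      (coset y-moves a)
    where
    from-fixed : ∀ {a} → φ a ≈ f → Fixed a → f ≈ 0# ⊎ f ≈ s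
    from-fixed φa≈f fix-a =
      Sum.map (trans (sym φa≈f)) (trans (sym φa≈f)) (φ-kernel (φφ≈0 fix-a))

    from-moved : ∀ {a g} → φ a ≈ f → Fixed g → a ≈ y + g → f ≈ φ y ⊎ f ≈ φ y + s
    from-moved {a} {g} φa≈f fix-g a≈y+g = Sum.map
      (λ eq → trans f≈ (trans (+-congˡ eq) (identityʳ (φ y))))
      (λ eq → trans f≈ (+-congˡ eq))
      (φ-kernel (φφ≈0 fix-g))
      where
      f≈ : f ≈ φ y + φ g
      f≈ = trans (sym φa≈f) (trans (φ-cong a≈y+g) (φ-+ y fix-g))

-- Isomorphisms from homomorphisms with trivial kernel

module _ {c₁ ℓ₁ c₂ ℓ₂} (G : Group c₁ ℓ₁) (H : Group c₂ ℓ₂) where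
  private
    module G = Group⁺ G
    module H = Group⁺ H
  open GroupMorphisms G.rawGroup H.rawGroup

  homo⇒isGroupHomomorphism : ∀ {f} → Congruent G._≈_ H._≈_ f →
    (∀ x y → f (x G.∙ y) H.≈ f x H.∙ f y) → IsGroupHomomorphism f
  homo⇒isGroupHomomorphism {f} f-cong homo = record
    { isMonoidHomomorphism = record
      { isMagmaHomomorphism = record
        { isRelHomomorphism = record { cong = f-cong } ; homo = homo }
      ; ε-homo = ε-homo
      }
    ; ⁻¹-homo = λ x → H.inverseˡ-unique (f (x G.⁻¹)) (f x)
        (H.trans (H.sym (homo (x G.⁻¹) x)) (H.trans (f-cong (G.inverseˡ x)) ε-homo))
    }
    where
    ε-homo : f G.ε H.≈ H.ε
    ε-homo = H.identityʳ-unique (f G.ε) (f G.ε)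
      (H.trans (H.sym (homo G.ε G.ε)) (f-cong (G.identityʳ G.ε)))

  trivialKernel⇒injective : ∀ {f} → Congruent G._≈_ H._≈_ f →
    (∀ x y → f (x G.∙ y) H.≈ f x H.∙ f y) →
    (∀ x → f x H.≈ H.ε → x G.≈ G.ε) → ∀ {x y} → f x H.≈ f y → x G.≈ y
  trivialKernel⇒injective {f} f-cong homo ker {x} {y} eq = G.x∙y⁻¹≈ε⇒x≈y x y (ker _ (begin
    f (x G.∙ y G.⁻¹)     ≈⟨ homo x (y G.⁻¹) ⟩
    f x H.∙ f (y G.⁻¹)   ≈⟨ H.∙-congʳ eq ⟩
    f y H.∙ f (y G.⁻¹)   ≈⟨ H.∙-congˡ (⁻¹-homo y) ⟩
    f y H.∙ f y H.⁻¹     ≈⟨ H.inverseʳ (f y) ⟩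
    H.ε                  ∎))
    where
    open SetoidReasoning H.setoid
    open IsGroupHomomorphism (homo⇒isGroupHomomorphism f-cong homo) using (⁻¹-homo)

module _ {c₁ ℓ₁ c₂ ℓ₂} (B : SkewBrace c₁ ℓ₁) (C : SkewBrace c₂ ℓ₂) where
  private
    module B = SkewBrace B
    module C = SkewBrace C
    B⁺ = record { isGroup = B.+-isGroup }
    C⁺ = record { isGroup = C.+-isGroup }
    B∘ = record { isGroup = B.∘-isGroup }
    C∘ = record { isGroup = C.∘-isGroup }
    module B⁺ = Group B⁺
    module C⁺ = Group C⁺
    module B∘ = Group B∘

  -- The isomorphism is built backwards: a map `g` out of the model is easy to write in coordinates,
  -- and `f` picks preimages under it. Injectivity of `g`, read off its additive kernel, determines
  -- these preimages, so `f` inherits compatibility with both operations.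
  inverse-≅ : (g : C.Carrier → B.Carrier) → Congruent C._≈_ B._≈_ g →
    (∀ p q → g (p C.+ q) B.≈ g p B.+ g q) →
    (∀ p q → g (p C.∘ q) B.≈ g p B.∘ g q) →
    (∀ p → g p B.≈ B.0# → p C.≈ C.0#) →
    (∀ b → ∃[ p ] g p B.≈ b) →
    B ≅ C
  inverse-≅ g g-cong +-homo ∘-homo ker surj =
    f
    , record
      { isGroupMonomorphism = record
        { isGroupHomomorphism = homo⇒isGroupHomomorphism B⁺ C⁺ f-cong λ a b →
            f-unique (B⁺.trans (+-homo (f a) (f b)) (B⁺.∙-cong (gf a) (gf b)))
        ; injective = f-injective
        }
      ; surjective = f-surjective
      }
    , record
      { isGroupMonomorphism = record
        { isGroupHomomorphism = homo⇒isGroupHomomorphism B∘ C∘ f-cong λ a b →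
            f-unique (B⁺.trans (∘-homo (f a) (f b)) (B∘.∙-cong (gf a) (gf b)))
        ; injective = f-injective
        }
      ; surjective = f-surjective
      }
    where
    f : B.Carrier → C.Carrier
    f b = proj₁ (surj b)

    gf : ∀ b → g (f b) B.≈ b
    gf b = proj₂ (surj b)

    f-unique : ∀ {b p} → g p B.≈ b → f b C.≈ p
    f-unique {b} eq = trivialKernel⇒injective C⁺ B⁺ g-cong +-homo ker
      (B⁺.trans (gf b) (B⁺.sym eq))

    f-cong : Congruent B._≈_ C._≈_ f
    f-cong {a} {b} eq = f-unique (B⁺.trans (gf b) (B⁺.sym eq))

    f-injective : ∀ {a b} → f a C.≈ f b → a B.≈ b
    f-injective {a} {b} eq = B⁺.trans (B⁺.sym (gf a)) (B⁺.trans (g-cong eq) (gf b))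

    f-surjective : ∀ p → ∃[ b ] (∀ {a} → a B.≈ b → f a C.≈ p)
    f-surjective p = g p , λ eq → f-unique (B⁺.sym eq)

-- Integer multiples and coordinates

module Classification {c ℓ} (B : SkewBrace c ℓ) (fin : Finite B)
  (+-comm : Commutative (SkewBrace._≈_ B) (SkewBrace._+_ B))
  (x : SkewBrace.Carrier B)
  (x-moves : ¬ AbelianType.Fixed B +-comm x)
  (single : FiniteAbelianType.SingleOrbit B fin +-comm x) where

  open OneOrbit B fin +-comm x x-moves single
  open CommutativeMonoidMult +-commutativeMonoid
    renaming ( _×_ to infixr 8 _·_; ×-congʳ to ·-congʳ; ×-congˡ to ·-congˡ; ×-homo-+ to ·-homo-+
             ; ×-assocˡ to ·-assocˡ; ×-distrib-+ to ·-distrib-+; ×-homo-1 to ·-homo-1)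

  ·-zeroʳ : ∀ n → n · 0# ≈ 0#
  ·-zeroʳ zero    = refl
  ·-zeroʳ (suc n) = trans (identityˡ (n · 0#)) (·-zeroʳ n)

  ·-mod : ∀ n .{{_ : NonZero n}} {a} → n · a ≈ 0# → ∀ m → toℕ (m mod n) · a ≈ m · a
  ·-mod n {a} na≈0 m = sym (begin
    m · a                           ≈⟨ ·-congˡ (m≡m%n+[m/n]*n m n) ⟩
    (m % n ℕ.+ m / n ℕ.* n) · a     ≈⟨ ·-homo-+ a (m % n) (m / n ℕ.* n) ⟩
    (m % n) · a + (m / n ℕ.* n) · a ≈⟨ +-congˡ (·-assocˡ a (m / n) n) ⟨
    (m % n) · a + (m / n) · n · a   ≈⟨ +-congˡ (trans (·-congʳ (m / n) na≈0) (·-zeroʳ (m / n))) ⟩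
    (m % n) · a + 0#                ≈⟨ identityʳ ((m % n) · a) ⟩
    (m % n) · a                     ≈⟨ ·-congˡ (Fin.toℕ-fromℕ< (m%n<n m n)) ⟨
    toℕ (m mod n) · a               ∎)

  module _ {n} .{{_ : NonZero n}} {a} (na≈0 : n · a ≈ 0#) where
    open Mod n using () renaming (_⊕_ to _⊞_; _⊗_ to _⊠_)

    ·-⊞ : ∀ i j → toℕ (i ⊞ j) · a ≈ toℕ i · a + toℕ j · a
    ·-⊞ i j = trans (·-mod n na≈0 (toℕ i ℕ.+ toℕ j)) (·-homo-+ a (toℕ i) (toℕ j))

    -- The factors are exchanged so that `j` ends up as the outer multiplier, matching the shape of
    -- the correction term in `act-multiple`.
    ·-⊠ : ∀ i j → toℕ (i ⊠ j) · a ≈ toℕ j · toℕ i · a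
    ·-⊠ i j = trans (·-mod n na≈0 (toℕ i ℕ.* toℕ j))
      (trans (·-congˡ (ℕ.*-comm (toℕ i) (toℕ j))) (sym (·-assocˡ a (toℕ j) (toℕ i))))

  combination-+ : ∀ {m n} .{{_ : NonZero m}} .{{_ : NonZero n}} {a b} →
    m · a ≈ 0# → n · b ≈ 0# → ∀ i j i′ j′ →
    toℕ (Mod._⊕_ m i i′) · a + toℕ (Mod._⊕_ n j j′) · b ≈
    (toℕ i · a + toℕ j · b) + (toℕ i′ · a + toℕ j′ · b)
  combination-+ {a = a} {b} ma≈0 nb≈0 i j i′ j′ = trans
    (+-cong (·-⊞ ma≈0 i i′) (·-⊞ nb≈0 j j′))
    (solve 4 (λ p p′ q q′ → (p ⊕ p′) ⊕ (q ⊕ q′) ⊜ (p ⊕ q) ⊕ (p′ ⊕ q′))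
       refl (toℕ i · a) (toℕ i′ · a) (toℕ j · b) (toℕ j′ · b))

  φφ≈s : ∀ a → ¬ φ (φ a) ≈ 0# → φ (φ a) ≈ s
  φφ≈s a w≉0 = [ (λ w≈0 → contradiction w≈0 w≉0) , id ]′ (φ-kernel (φφ≈0 (φ-fixed a)))

  fixed-2· : ∀ {f} → Fixed f → 2 · f ≈ 0#
  fixed-2· {f} fix = trans (+-congˡ (identityʳ f)) (fixed-2-torsion fix)

  fixed-· : ∀ n {f} → Fixed f → Fixed (n · f)
  fixed-· zero    fix = fixed-0
  fixed-· (suc n) fix = fixed-+ fix (fixed-· n fix)

  φ-· : ∀ n {f} → Fixed f → φ (n · f) ≈ n · φ f
  φ-· zero        fix = φ-0
  φ-· (suc n) {f} fix = trans (φ-+ f (fixed-· n fix)) (+-congˡ (φ-· n fix))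

  module _ {y} (y-moves : ¬ Fixed y) where

    act-multiple : ∀ a n → act a (n · y) ≈ n · y + n · φ a
    act-multiple a zero    = trans (act-zeroʳ a) (sym (identityˡ 0#))
    act-multiple a (suc n) = begin
      act a (y + n · y)                 ≈⟨ act-+ a y (n · y) ⟩
      act a y + act a (n · y)           ≈⟨ +-cong (act-moving y-moves a) (act-multiple a n) ⟩
      (y + φ a) + (n · y + n · φ a)
        ≈⟨ solve 4 (λ y p ny np → (y ⊕ p) ⊕ (ny ⊕ np) ⊜ (y ⊕ ny) ⊕ (p ⊕ np))
             refl y (φ a) (n · y) (n · φ a) ⟩
      (y + n · y) + (φ a + n · φ a)     ∎

    φ-1· : φ (1 · y) ≈ φ y
    φ-1· = φ-cong (·-homo-1 y)

    φ-2· : φ (2 · y) ≈ φ (y + y)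
    φ-2· = φ-cong (+-congˡ (·-homo-1 y))

    -- `φ-+` asks for a fixed right summand, so the triple is split as `y` plus the fixed point
    -- `y + y`.
    φ-3· : φ (3 · y) ≈ φ y + φ (y + y)
    φ-3· = trans (φ-cong (+-congˡ (+-congˡ (·-homo-1 y)))) (φ-+ y (double-fixed y-moves))

    order-4 : 4 · y ≈ 0#
    order-4 = begin
      y + (y + (y + 1 · y)) ≈⟨ +-congˡ (+-congˡ (+-congˡ (·-homo-1 y))) ⟩
      y + (y + (y + y))     ≈⟨ assoc y y (y + y) ⟨
      (y + y) + (y + y)     ≈⟨ fixed-2-torsion (double-fixed y-moves) ⟩
      0#                    ∎

    odd≉0 : ∀ {f} → Fixed f → ¬ y + f ≈ 0#
    odd≉0 fix eq = moves-+ y-moves fix (fixed-resp (sym eq) fixed-0)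

    module _ {w} (w-fixed : Fixed w) (φw≈0 : φ w ≈ 0#) where

      φ-combination : ∀ i a → φ (i · w + a) ≈ φ a
      φ-combination i a = begin
        φ (i · w + a)     ≈⟨ φ-cong (comm (i · w) a) ⟩
        φ (a + i · w)     ≈⟨ φ-+ a (fixed-· i w-fixed) ⟩
        φ a + φ (i · w)   ≈⟨ +-congˡ (φ-· i w-fixed) ⟩
        φ a + i · φ w     ≈⟨ +-congˡ (trans (·-congʳ i φw≈0) (·-zeroʳ i)) ⟩
        φ a + 0#          ≈⟨ identityʳ (φ a) ⟩
        φ a               ∎

      -- Because `w` is fixed and killed by `φ`, multiplication differs from addition only by `j′`
      -- copies of the displacement `φ (j · y)`. Each two-coordinate model is matched by evaluating
      -- that displacement.
      combination-∘ : ∀ i j i′ j′ → (i · w + j · y) ∘ (i′ · w + j′ · y) ≈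
        (i · w + i′ · w) + (j · y + j′ · y + j′ · φ (j · y))
      combination-∘ i j i′ j′ = begin
        a ∘ (i′ · w + j′ · y)
          ≈⟨ ∘≈+act a _ ⟩
        a + act a (i′ · w + j′ · y)
          ≈⟨ +-congˡ (act-+ a (i′ · w) (j′ · y)) ⟩
        a + (act a (i′ · w) + act a (j′ · y))
          ≈⟨ +-congˡ (+-cong (fixed-· i′ w-fixed a) (act-multiple a j′)) ⟩
        a + (i′ · w + (j′ · y + j′ · φ a))
          ≈⟨ +-congˡ (+-congˡ (+-congˡ (·-congʳ j′ (φ-combination i (j · y))))) ⟩
        a + (i′ · w + (j′ · y + j′ · φ (j · y)))
          ≈⟨ solve 5 (λ p q p′ q′ r → (p ⊕ q) ⊕ (p′ ⊕ (q′ ⊕ r)) ⊜ (p ⊕ p′) ⊕ ((q ⊕ q′) ⊕ r))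
               refl (i · w) (j · y) (i′ · w) (j′ · y) (j′ · φ (j · y)) ⟩
        (i · w + i′ · w) + (j · y + j′ · y + j′ · φ (j · y)) ∎
        where
        a = i · w + j · y

  -- Identification with the three model braces

  order-4⇒Brace₁ : φ (φ x) ≈ 0# → ¬ φ x ≈ 0# → (∀ {f} → Fixed f → f ≈ 0# ⊎ f ≈ φ x) →
                   x + x ≈ φ x → B ≅ Brace₁.brace
  order-4⇒Brace₁ φu≈0 u≉0 fixed-01 2x≈u =
    inverse-≅ B Brace₁.brace g (λ eq → reflexive (≡.cong g eq)) (·-⊞ 4x≈0) ∘-homo kernel surj
    where
    open Mod 4 renaming (_⊕_ to infixl 6 _⊞_; _⊗_ to infixl 7 _⊠_)

    g : Fin 4 → Carrier
    g i = toℕ i · x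

    4x≈0 = order-4 x-moves

    φ[2x]≈0 : φ (x + x) ≈ 0#
    φ[2x]≈0 = trans (φ-cong 2x≈u) φu≈0

    2·x≈φx : 2 · x ≈ φ x
    2·x≈φx = trans (+-congˡ (·-homo-1 x)) 2x≈u

    -- Here `x` is an additive generator and `φ x` is its double, so `φ` doubles coordinates; this
    -- produces the term 2xy of brace (1).
    φg : ∀ i → φ (g i) ≈ g (2F ⊠ i)
    φg 0F = φ-0
    φg 1F = trans (φ-1· x-moves) (sym 2·x≈φx)
    φg 2F = trans (φ-2· x-moves) φ[2x]≈0
    φg 3F = trans (φ-3· x-moves)
      (trans (+-congˡ φ[2x]≈0) (trans (identityʳ (φ x)) (sym 2·x≈φx)))

    ∘-homo : ∀ i j → g (i ⊞ j ⊞ 2F ⊠ i ⊠ j) ≈ g i ∘ g j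
    ∘-homo i j = begin
      g (i ⊞ j ⊞ 2F ⊠ i ⊠ j)         ≈⟨ ·-⊞ 4x≈0 (i ⊞ j) (2F ⊠ i ⊠ j) ⟩
      g (i ⊞ j) + g (2F ⊠ i ⊠ j)     ≈⟨ +-cong (·-⊞ 4x≈0 i j) (·-⊠ 4x≈0 (2F ⊠ i) j) ⟩
      g i + g j + toℕ j · g (2F ⊠ i) ≈⟨ +-congˡ (·-congʳ (toℕ j) (φg i)) ⟨
      g i + g j + toℕ j · φ (g i)    ≈⟨ assoc _ _ _ ⟩
      g i + (g j + toℕ j · φ (g i))  ≈⟨ +-congˡ (act-multiple x-moves (g i) (toℕ j)) ⟨
      g i + act (g i) (g j)          ≈⟨ ∘≈+act (g i) (g j) ⟨
      g i ∘ g j                      ∎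

    kernel : ∀ i → g i ≈ 0# → i ≡ 0F
    kernel 0F _  = ≡.refl
    kernel 1F eq = contradiction eq (odd≉0 x-moves fixed-0)
    kernel 2F eq = contradiction (trans (sym 2·x≈φx) eq) u≉0
    kernel 3F eq = contradiction eq
      (odd≉0 x-moves (fixed-resp (sym 2·x≈φx) (φ-fixed x)))

    surj : ∀ b → ∃[ i ] g i ≈ b
    surj b with coset x-moves b
    ... | inj₁ fix with fixed-01 fix
    ...   | inj₁ b≈0 = 0F , sym b≈0
    ...   | inj₂ b≈u = 2F , trans 2·x≈φx (sym b≈u)
    surj b | inj₂ (f , fix , b≈x+f) with fixed-01 fix
    ...   | inj₁ f≈0 = 1F , trans (+-congˡ (sym f≈0)) (sym b≈x+f)
    ...   | inj₂ f≈u = 3F , trans (+-congˡ (trans 2·x≈φx (sym f≈u))) (sym b≈x+f)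

  -- Coordinates are taken along `φ x` and `x`, both of order two. The displacement caused by
  -- `j · x` is `j · φ x`, which puts the product of the second coordinates into the first one.
  order-2⇒Brace₂ : φ (φ x) ≈ 0# → ¬ φ x ≈ 0# → (∀ {f} → Fixed f → f ≈ 0# ⊎ f ≈ φ x) →
                   x + x ≈ 0# → B ≅ Brace₂.brace
  order-2⇒Brace₂ φu≈0 u≉0 fixed-01 2x≈0 =
    inverse-≅ B Brace₂.brace g (λ eq → reflexive (≡.cong g eq)) +-homo ∘-homo kernel surj
    where
    open Mod 2 renaming (_⊕_ to infixl 6 _⊞_; _⊗_ to infixl 7 _⊠_)

    u = φ x
    2u≈0 = fixed-2· (φ-fixed x)

    2·x≈0 : 2 · x ≈ 0#
    2·x≈0 = trans (+-congˡ (·-homo-1 x)) 2x≈0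

    g : Fin 2 × Fin 2 → Carrier
    g (i , j) = toℕ i · u + toℕ j · x

    +-homo : ∀ p q → g (p Brace₂.+ q) ≈ g p + g q
    +-homo (i , j) (i′ , j′) = combination-+ 2u≈0 2·x≈0 i j i′ j′

    φg : ∀ j → φ (toℕ j · x) ≈ toℕ j · u
    φg 0F = φ-0
    φg 1F = trans (φ-1· x-moves) (sym (·-homo-1 u))

    ∘-homo : ∀ p q → g (p Brace₂.∘ q) ≈ g p ∘ g q
    ∘-homo (i , j) (i′ , j′) = begin
      toℕ (i ⊞ i′ ⊞ j ⊠ j′) · u + toℕ (j ⊞ j′) · x
        ≈⟨ +-cong (·-⊞ 2u≈0 (i ⊞ i′) (j ⊠ j′)) (·-⊞ 2·x≈0 j j′) ⟩
      (toℕ (i ⊞ i′) · u + toℕ (j ⊠ j′) · u) + (toℕ j · x + toℕ j′ · x)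
        ≈⟨ +-congʳ (+-cong (·-⊞ 2u≈0 i i′)
             (trans (·-⊠ 2u≈0 j j′) (·-congʳ (toℕ j′) (sym (φg j))))) ⟩
      (toℕ i · u + toℕ i′ · u + toℕ j′ · φ (toℕ j · x)) + (toℕ j · x + toℕ j′ · x)
        ≈⟨ solve 3 (λ p q r → (p ⊕ q) ⊕ r ⊜ p ⊕ (r ⊕ q)) refl
             (toℕ i · u + toℕ i′ · u) (toℕ j′ · φ (toℕ j · x)) (toℕ j · x + toℕ j′ · x) ⟩
      (toℕ i · u + toℕ i′ · u) + (toℕ j · x + toℕ j′ · x + toℕ j′ · φ (toℕ j · x))
        ≈⟨ combination-∘ x-moves (φ-fixed x) φu≈0 (toℕ i) (toℕ j) (toℕ i′) (toℕ j′) ⟨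
      g (i , j) ∘ g (i′ , j′) ∎

    kernel : ∀ p → g p ≈ 0# → p ≡ (0F , 0F)
    kernel (0F , 0F) _  = ≡.refl
    kernel (1F , 0F) eq = contradiction
      (trans (sym (trans (identityʳ (1 · u)) (·-homo-1 u))) eq) u≉0
    kernel (0F , 1F) eq = contradiction (trans (sym (identityˡ (1 · x))) eq)
      (odd≉0 x-moves fixed-0)
    kernel (1F , 1F) eq = contradiction
      (trans (trans (comm x (1 · u)) (+-congˡ (sym (·-homo-1 x)))) eq)
      (odd≉0 x-moves (fixed-· 1 (φ-fixed x)))

    surj : ∀ b → ∃[ p ] g p ≈ b
    surj b with coset x-moves b
    ... | inj₁ fix with fixed-01 fix
    ...   | inj₁ b≈0 = (0F , 0F) , trans (identityʳ 0#) (sym b≈0)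
    ...   | inj₂ b≈u = (1F , 0F) , trans (identityʳ (1 · u)) (trans (·-homo-1 u) (sym b≈u))
    surj b | inj₂ (f , fix , b≈x+f) with fixed-01 fix
    ...   | inj₁ f≈0 = (0F , 1F) ,
      trans (identityˡ (1 · x)) (trans (+-congˡ (sym f≈0)) (sym b≈x+f))
    ...   | inj₂ f≈u = (1F , 1F) , (begin
      1 · u + 1 · x ≈⟨ +-cong (·-homo-1 u) (·-homo-1 x) ⟩
      u + x         ≈⟨ comm u x ⟩
      x + u         ≈⟨ +-congˡ f≈u ⟨
      x + f         ≈⟨ b≈x+f ⟨
      b             ∎)

  -- The fixed points form a Klein four-group generated by `φ y` and `φ (φ y)`. As `φ y` is the
  -- double of `y`, coordinates along `φ (φ y)` and `y`, of orders two and four, cover everything.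
  klein⇒Brace₃ : ∀ {y} → ¬ Fixed y → ¬ φ (φ y) ≈ 0# → y + y ≈ φ y → B ≅ Brace₃.brace
  klein⇒Brace₃ {y} y-moves w≉0 2y≈v =
    inverse-≅ B Brace₃.brace g (λ eq → reflexive (≡.cong g eq)) +-homo ∘-homo kernel surj
    where
    open Mod 2 using () renaming (_⊕_ to infixl 6 _⊞₂_; _⊗_ to infixl 7 _⊠₂_)
    open Mod 4 using () renaming (_⊕_ to infixl 6 _⊞₄_; _⊗_ to infixl 7 _⊠₄_)
    open Brace₃ using (ε; reduce)

    v = φ y
    w = φ v

    w-fixed : Fixed w
    w-fixed = φ-fixed v

    φw≈0 : φ w ≈ 0#
    φw≈0 = φφ≈0 (φ-fixed y)

    2w≈0 = fixed-2· w-fixed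
    4y≈0 = order-4 y-moves

    1·w≈w : 1 · w + 0# ≈ w
    1·w≈w = trans (identityʳ (1 · w)) (·-homo-1 w)

    2·y≈v : 2 · y ≈ v
    2·y≈v = trans (+-congˡ (·-homo-1 y)) 2y≈v

    3·y≈y+v : 3 · y ≈ y + v
    3·y≈y+v = +-congˡ 2·y≈v

    w≈s = φφ≈s y w≉0

    g : Fin 2 × Fin 4 → Carrier
    g (i , j) = toℕ i · w + toℕ j · y

    +-homo : ∀ p q → g (p Brace₃.+ q) ≈ g p + g q
    +-homo (i , j) (i′ , j′) = combination-+ 2w≈0 4y≈0 i j i′ j′

    -- On the multiples 0, 1, 2, 3 of `y` the displacement is `0#`, `v`, `w`, `w + v`. Reading `v`
    -- as `2 · y` separates it into the ε-part along `w` and the doubling along `y`.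
    φg : ∀ j → φ (toℕ j · y) ≈ toℕ (ε j) · w + toℕ (2F ⊠₄ j) · y
    φg 0F = trans φ-0 (sym (identityʳ 0#))
    φg 1F = trans (φ-1· y-moves) (sym (trans (identityˡ (2 · y)) 2·y≈v))
    φg 2F = trans (φ-2· y-moves) (trans (φ-cong 2y≈v) (sym 1·w≈w))
    φg 3F = begin
      φ (3 · y)       ≈⟨ φ-3· y-moves ⟩
      v + φ (y + y)   ≈⟨ +-congˡ (φ-cong 2y≈v) ⟩
      v + w           ≈⟨ comm v w ⟩
      w + v           ≈⟨ +-cong (·-homo-1 w) 2·y≈v ⟨
      1 · w + 2 · y   ∎

    -- Two kills every multiple of `w`, so reducing `j′` modulo two beforehand changes nothing.
    ε-term : ∀ j j′ → toℕ (ε j ⊠₂ reduce j′) · w ≈ toℕ j′ · toℕ (ε j) · w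
    ε-term j j′ = trans (·-⊠ 2w≈0 (ε j) (reduce j′))
      (·-mod 2 (fixed-2· (fixed-· (toℕ (ε j)) w-fixed)) (toℕ j′))

    ∘-homo : ∀ p q → g (p Brace₃.∘ q) ≈ g p ∘ g q
    ∘-homo (i , j) (i′ , j′) = begin
      toℕ (i ⊞₂ i′ ⊞₂ ε j ⊠₂ reduce j′) · w + toℕ (j ⊞₄ j′ ⊞₄ 2F ⊠₄ j ⊠₄ j′) · y
        ≈⟨ +-cong (·-⊞ 2w≈0 (i ⊞₂ i′) (ε j ⊠₂ reduce j′))
                  (·-⊞ 4y≈0 (j ⊞₄ j′) (2F ⊠₄ j ⊠₄ j′)) ⟩
      (toℕ (i ⊞₂ i′) · w + toℕ (ε j ⊠₂ reduce j′) · w) +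
        (toℕ (j ⊞₄ j′) · y + toℕ (2F ⊠₄ j ⊠₄ j′) · y)
        ≈⟨ +-cong (+-cong (·-⊞ 2w≈0 i i′) (ε-term j j′))
                  (+-cong (·-⊞ 4y≈0 j j′) (·-⊠ 4y≈0 (2F ⊠₄ j) j′)) ⟩
      (W + toℕ j′ · E) + (Y + toℕ j′ · D)
        ≈⟨ solve 4 (λ p e q d → (p ⊕ e) ⊕ (q ⊕ d) ⊜ p ⊕ (q ⊕ (e ⊕ d)))
             refl W (toℕ j′ · E) Y (toℕ j′ · D) ⟩
      W + (Y + (toℕ j′ · E + toℕ j′ · D))
        ≈⟨ +-congˡ (+-congˡ (·-distrib-+ E D (toℕ j′))) ⟨
      W + (Y + toℕ j′ · (E + D))
        ≈⟨ +-congˡ (+-congˡ (·-congʳ (toℕ j′) (φg j))) ⟨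
      W + (Y + toℕ j′ · φ (toℕ j · y))
        ≈⟨ combination-∘ y-moves w-fixed φw≈0 (toℕ i) (toℕ j) (toℕ i′) (toℕ j′) ⟨
      g (i , j) ∘ g (i′ , j′) ∎
      where
      W = toℕ i · w + toℕ i′ · w
      Y = toℕ j · y + toℕ j′ · y
      E = toℕ (ε j) · w
      D = toℕ (2F ⊠₄ j) · y

    -- Applying `φ` removes the multiple of `w` and turns `2 · y` into the nonzero `w`.
    kernel-even : ∀ i → ¬ toℕ i · w + 2 · y ≈ 0#
    kernel-even i eq = w≉0 (begin
      φ v                   ≈⟨ φ-cong 2·y≈v ⟨
      φ (2 · y)             ≈⟨ φ-combination y-moves w-fixed φw≈0 (toℕ i) (2 · y) ⟨
      φ (toℕ i · w + 2 · y) ≈⟨ φ-cong eq ⟩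
      φ 0#                  ≈⟨ φ-0 ⟩
      0#                    ∎)

    kernel-odd : ∀ i {f} → Fixed f → ¬ toℕ i · w + (y + f) ≈ 0#
    kernel-odd i {f} fix eq = odd≉0 y-moves (fixed-+ (fixed-· (toℕ i) w-fixed) fix) (trans
      (solve 3 (λ y p f → y ⊕ (p ⊕ f) ⊜ p ⊕ (y ⊕ f)) refl y (toℕ i · w) f) eq)

    kernel : ∀ p → g p ≈ 0# → p ≡ (0F , 0F)
    kernel (0F , 0F) _  = ≡.refl
    kernel (1F , 0F) eq = contradiction (trans (sym 1·w≈w) eq) w≉0
    kernel (i  , 1F) eq = contradiction eq (kernel-odd i fixed-0)
    kernel (i  , 2F) eq = contradiction eq (kernel-even i)
    kernel (i  , 3F) eq = contradiction eq
      (kernel-odd i (fixed-resp (sym 2·y≈v) (φ-fixed y)))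

    s≈1·w : s ≈ 1 · w
    s≈1·w = trans (sym w≈s) (sym (·-homo-1 w))

    -- Since `w` is the nonzero kernel element `s`, the four cases of `fixed-cases` become the four
    -- pairs whose second coordinate is 0 or 2.
    fixed-coordinates : ∀ {f} → Fixed f → ∃[ i ] (f ≈ toℕ {2} i · w ⊎ f ≈ v + toℕ {2} i · w)
    fixed-coordinates {f} fix = coordinates (fixed-cases y-moves fix)
      where
      coordinates : (f ≈ 0# ⊎ f ≈ s) ⊎ (f ≈ v ⊎ f ≈ v + s) →
                    ∃[ i ] (f ≈ toℕ {2} i · w ⊎ f ≈ v + toℕ {2} i · w)
      coordinates (inj₁ (inj₁ f≈0))   = 0F , inj₁ f≈0
      coordinates (inj₁ (inj₂ f≈s))   = 1F , inj₁ (trans f≈s s≈1·w)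
      coordinates (inj₂ (inj₁ f≈v))   = 0F , inj₂ (trans f≈v (sym (identityʳ v)))
      coordinates (inj₂ (inj₂ f≈v+s)) = 1F , inj₂ (trans f≈v+s (+-congˡ s≈1·w))

    surj : ∀ b → ∃[ p ] g p ≈ b
    surj b = [ (λ fix → even (fixed-coordinates fix))
             , (λ (f , fix , b≈y+f) → odd b≈y+f (fixed-coordinates fix))
             ]′ (coset y-moves b)
      where
      even : ∃[ i ] (b ≈ toℕ {2} i · w ⊎ b ≈ v + toℕ {2} i · w) → ∃[ p ] g p ≈ b
      even (i , inj₁ b≈) = (i , 0F) , trans (identityʳ (toℕ i · w)) (sym b≈)
      even (i , inj₂ b≈) = (i , 2F) , (begin
        toℕ i · w + 2 · y   ≈⟨ +-congˡ 2·y≈v ⟩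
        toℕ i · w + v       ≈⟨ comm (toℕ i · w) v ⟩
        v + toℕ i · w       ≈⟨ b≈ ⟨
        b                   ∎)

      odd : ∀ {f} → b ≈ y + f → ∃[ i ] (f ≈ toℕ {2} i · w ⊎ f ≈ v + toℕ {2} i · w) →
            ∃[ p ] g p ≈ b
      odd {f} b≈y+f (i , inj₁ f≈) = (i , 1F) , (begin
        toℕ i · w + 1 · y   ≈⟨ +-congˡ (·-homo-1 y) ⟩
        toℕ i · w + y       ≈⟨ comm (toℕ i · w) y ⟩
        y + toℕ i · w       ≈⟨ +-congˡ f≈ ⟨
        y + f               ≈⟨ b≈y+f ⟨
        b                   ∎)
      odd {f} b≈y+f (i , inj₂ f≈) = (i , 3F) , (begin
        toℕ i · w + 3 · y   ≈⟨ +-congˡ 3·y≈y+v ⟩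
        toℕ i · w + (y + v) ≈⟨ comm (toℕ i · w) (y + v) ⟩
        y + v + toℕ i · w   ≈⟨ assoc y v (toℕ i · w) ⟩
        y + (v + toℕ i · w) ≈⟨ +-congˡ f≈ ⟨
        y + f               ≈⟨ b≈y+f ⟨
        b                   ∎)

  -- The case distinction on φ (φ x)

  φx≈0⇒φ≈0 : φ x ≈ 0# → ∀ a → φ a ≈ 0#
  φx≈0⇒φ≈0 u≈0 a = [ φ-fixed≈0 , φ-moved≈0 ]′ (coset x-moves a)
    where
    φ-fixed≈0 : ∀ {f} → Fixed f → φ f ≈ 0#
    φ-fixed≈0 {f} fix = [ [ f≈0⇒ , f≈s⇒ ]′
                        , [ f≈0⇒ ∘′ (λ f≈u → trans f≈u u≈0)
                          , f≈s⇒ ∘′ (λ f≈u+s → trans f≈u+s (trans (+-congʳ u≈0) (identityˡ s)))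
                          ]′
                        ]′ (fixed-cases x-moves fix)
      where
      f≈0⇒ : f ≈ 0# → φ f ≈ 0#
      f≈0⇒ f≈0 = trans (φ-cong f≈0) φ-0

      f≈s⇒ : f ≈ s → φ f ≈ 0#
      f≈s⇒ f≈s = trans (φ-cong f≈s) φ-s

    φ-moved≈0 : ∃[ f ] Fixed f × a ≈ x + f → φ a ≈ 0#
    φ-moved≈0 (f , fix , a≈x+f) = begin
      φ a       ≈⟨ φ-cong a≈x+f ⟩
      φ (x + f) ≈⟨ φ-+ x fix ⟩
      φ x + φ f ≈⟨ +-cong u≈0 (φ-fixed≈0 fix) ⟩
      0# + 0#   ≈⟨ identityʳ 0# ⟩
      0#        ∎

  -- If `φ x` vanished, `fixed-cases` would leave only `0#` and `s` as fixed points; `φ` would then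
  -- vanish everywhere, and every element would stabilize `x`.
  φx≉0 : ¬ φ x ≈ 0#
  φx≉0 u≈0 = x-moves λ a → φ≈0⇒act-x (φx≈0⇒φ≈0 u≈0 a)

  φx≈s : φ (φ x) ≈ 0# → φ x ≈ s
  φx≈s φu≈0 = [ (λ u≈0 → contradiction u≈0 φx≉0) , id ]′ (φ-kernel φu≈0)

  -- Here `φ x` is a nonzero kernel element, hence `s`. The four cases collapse in pairs, with
  -- `φ x + s` becoming twice `φ x`, that is zero.
  φφx≈0⇒fixed-01 : φ (φ x) ≈ 0# → ∀ {f} → Fixed f → f ≈ 0# ⊎ f ≈ φ x
  φφx≈0⇒fixed-01 φu≈0 fix =
    [ Sum.map₂ (λ f≈s → trans f≈s (sym u≈s))
    , [ inj₂
      , (λ f≈u+s → inj₁ (trans f≈u+s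
          (trans (+-congˡ (sym u≈s)) (fixed-2-torsion (φ-fixed x)))))
      ]′
    ]′ (fixed-cases x-moves fix)
    where
    u≈s = φx≈s φu≈0

  φ[2x]≉0 : ¬ φ (φ x) ≈ 0# → ¬ φ (x + x) ≈ 0#
  φ[2x]≉0 w≉0 eq = w≉0 (begin
    φ (φ x)             ≈⟨ identityˡ (φ (φ x)) ⟨
    0# + φ (φ x)        ≈⟨ +-congʳ eq ⟨
    φ (x + x) + φ (φ x) ≈⟨ φ-double x-moves ⟩
    0#                  ∎)

  -- Replacing x by x + φ x changes φ x to φ x + s and leaves x + x as it is.
  shifted⇒Brace₃ : ¬ φ (φ x) ≈ 0# → x + x ≈ φ x + s → B ≅ Brace₃.brace
  shifted⇒Brace₃ w≉0 2x≈u+s = klein⇒Brace₃ (moves-+ x-moves u-fixed)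
    (λ eq → w≉0 (begin
      φ (φ x)           ≈⟨ identityʳ _ ⟨
      φ (φ x) + 0#      ≈⟨ +-congˡ (φφ≈0 u-fixed) ⟨
      φ (φ x) + φ (φ (φ x)) ≈⟨ φ-+ (φ x) (φ-fixed (φ x)) ⟨
      φ (φ x + φ (φ x)) ≈⟨ φ-cong (φ-+ x u-fixed) ⟨
      φ (φ (x + φ x))   ≈⟨ eq ⟩
      0#                ∎))
    (begin
      (x + φ x) + (x + φ x)
        ≈⟨ solve 2 (λ x u → (x ⊕ u) ⊕ (x ⊕ u) ⊜ (x ⊕ x) ⊕ (u ⊕ u)) refl x (φ x) ⟩
      (x + x) + (φ x + φ x) ≈⟨ +-congˡ (fixed-2-torsion u-fixed) ⟩
      (x + x) + 0#          ≈⟨ identityʳ (x + x) ⟩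
      x + x                 ≈⟨ 2x≈u+s ⟩
      φ x + s               ≈⟨ +-congˡ (φφ≈s x w≉0) ⟨
      φ x + φ (φ x)         ≈⟨ φ-+ x u-fixed ⟨
      φ (x + φ x)           ∎)
    where
    u-fixed = φ-fixed x

  -- The double of `x` is fixed, hence `0#` or `φ x`; this decides whether the additive group is a
  -- Klein four-group or cyclic.
  classify-φφx≈0 : φ (φ x) ≈ 0# → B ≅ Brace₁.brace ⊎ B ≅ Brace₂.brace
  classify-φφx≈0 φu≈0 =
    [ (λ 2x≈0 → inj₂ (order-2⇒Brace₂ φu≈0 φx≉0 fixed-01 2x≈0))
    , (λ 2x≈u → inj₁ (order-4⇒Brace₁ φu≈0 φx≉0 fixed-01 2x≈u))
    ]′ (fixed-01 (double-fixed x-moves))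
    where
    fixed-01 : ∀ {f} → Fixed f → f ≈ 0# ⊎ f ≈ φ x
    fixed-01 = φφx≈0⇒fixed-01 φu≈0

  -- Of the four possible values of `x + x`, `0#` and `s` are excluded because `φ` kills them but
  -- not `x + x`. The value `φ x` is the normal form of the third brace, and `φ x + s` is brought to
  -- it by changing the base point.
  classify-φφx≉0 : ¬ φ (φ x) ≈ 0# → B ≅ Brace₃.brace
  classify-φφx≉0 w≉0 =
    [ [ (λ 2x≈0 → contradiction (trans (φ-cong 2x≈0) φ-0) (φ[2x]≉0 w≉0))
      , (λ 2x≈s → contradiction (trans (φ-cong 2x≈s) φ-s) (φ[2x]≉0 w≉0))
      ]′
    , [ klein⇒Brace₃ x-moves w≉0 , shifted⇒Brace₃ w≉0 ]′
    ]′ (fixed-cases x-moves (double-fixed x-moves))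

  classify : B ≅ Brace₁.brace ⊎ B ≅ Brace₂.brace ⊎ B ≅ Brace₃.brace
  classify = split (φ (φ x) ≟ 0#)
    where
    split : Dec (φ (φ x) ≈ 0#) → B ≅ Brace₁.brace ⊎ B ≅ Brace₂.brace ⊎ B ≅ Brace₃.brace
    split (yes w≈0) = Sum.map₂ inj₁ (classify-φφx≈0 w≈0)
    split (no w≉0)  = inj₂ (inj₂ (classify-φφx≉0 w≉0))

mainTheorem15 : ∀ {c ℓ} (B : SkewBrace c ℓ) (fin : Finite B) →
    Commutative (SkewBrace._≈_ B) (SkewBrace._+_ B) →
    HasExactlyOneVertex (Λ B fin) →
    B ≅ Brace₁.brace ⊎ B ≅ Brace₂.brace ⊎ B ≅ Brace₃.brace
mainTheorem15 B fin +-comm oneVertex =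
  let x , x-moves , single = FiniteAbelianType.oneVertex⇒singleOrbit B fin +-comm oneVertex
  in Classification.classify B fin +-comm x x-moves single
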